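{- The following filling-shape-Wilf-equivalences of consecutive patterns hold: $$1342\equiv_{\mathrm{fs}}1432,\qquad 2341\equiv_{\mathrm{fs}}2431,\qquad 4213\equiv_{\mathrm{fs}}4123,\qquad 3214\equiv_{\mathrm{fs}}3124.$$
   Context: Two sequences of positive integers of the same length are order-isomorphic, $a_1\cdots a_k\sim b_1\cdots b_k$, if for all $p,q$ one has $a_p<a_q$ iff $b_p<b_q$. A consecutive pattern is a permutation $\sigma_1\cdots\sigma_k$ of $\{1,\dots,k\}$, whose occurrences are required to be in adjacent positions, as follows. Young diagrams are drawn in French notation: a Young diagram $D$ with $n$ columns and $m$ rows is a set of cells (column, row) in $\{1,\dots,n\}\times\{1,\dots,m\}$ such that if $(a,b)\in D$ then $(a',b')\in D$ for all $1\le a'\le a$, $1\le b'\le b$; the cell $(1,1)$ is at the bottom left. A filling of $D$ is a set of selected cells of $D$ with no two in the same column and no two in the same row. For a column $c$ containing a selected cell, let $\pi(c)$ be the row of that cell. A filling contains the consecutive pattern $\sigma_1\cdots\sigma_k$ if there are consecutive columns $i_1<\cdots<i_k$ (that is, $i_{p+1}-i_p=1$ for $1\le p\le k-1$) such that $(i_1,\pi(i_1)),\dots,(i_k,\pi(i_k))$ are selected cells, $\pi(i_1)\cdots\pi(i_k)\sim\sigma_1\cdots\sigma_k$, and $(i_p,\pi(i_q))\in D$ for all $1\le p,q\le k$. Otherwise it avoids the pattern. Two patterns $\sigma,\tau$ are filling-shape-Wilf-equivalent, $\sigma\equiv_{\mathrm{fs}}\tau$, if for every Young diagram $D$, every set $R$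 of rows and every set $C$ of columns, the number of fillings of $D$ avoiding $\sigma$ whose set of rows without a selected cell is exactly $R$ and whose set of columns without a selected cell is exactly $C$ equals the number of such fillings avoiding $\tau$. -}

module Defs where

open import Data.Fin.Base using (Fin; toℕ) renaming (_≤_ to _≤ᶠ_)
import Data.Fin.Properties as Fin
open import Data.Fin.Subset using (Subset; _∈_; inside; outside)
open import Data.Fin.Subset.Properties using (_∈?_)
open import Data.List.Base as List using (List; []; _∷_; cartesianProductWith; filter; length; upTo)
open import Data.List.Relation.Binary.Permutation.Propositional using (_↭_; ↭-sym)
import Data.Nat.Properties as ℕ
open import Data.List.Sort.Base ℕ.≤-totalOrder using (module SortingAlgorithm)
open import Data.List.Sort.MergeSort ℕ.≤-decTotalOrder using (mergeSort)
open import Data.Nat.Base using (ℕ; zero; suc; _<_)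
open import Data.Product.Base using (_×_; _,_; ∃; ∃-syntax; uncurry)
open import Data.Vec.Base using (Vec; []; _∷_; lookup; map; toList)
open import Function.Bundles using (_⇔_; mk⇔; Equivalence)
open import Relation.Binary.PropositionalEquality using (_≡_)
open import Relation.Nullary.Decidable using (Dec; ¬?; _×-dec_; _→-dec_; map′)
open import Relation.Nullary.Negation using (¬_)
open import Relation.Unary using (Decidable)

private
  variable
    k l m n : ℕ

-- Columns and rows are numbered from 0 by Fin.  Order-isomorphism and adjacency
-- of columns do not depend on this shift; pattern words keep the letters 1, …, k.

_∼_ : Vec ℕ k → Vec ℕ k → Set
a ∼ b = ∀ p q → (lookup a p < lookup a q) ⇔ (lookup b p < lookup b q)

record Pattern (k : ℕ) : Set where
  field
    word          : Vec ℕ k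
    isPermutation : toList word ↭ List.map suc (upTo k)

open Pattern public

-- The i-th entry is the set of rows j such that the cell (i , j) is present.
CellSet : ℕ → ℕ → Set
CellSet n m = Vec (Subset m) n

_∈ᶜ_ : Fin n × Fin m → CellSet n m → Set
(i , j) ∈ᶜ S = j ∈ lookup S i

record YoungDiagram (n m : ℕ) : Set where
  field
    cells      : CellSet n m
    downClosed : ∀ {a b a′ b′} → (a , b) ∈ᶜ cells → a′ ≤ᶠ a → b′ ≤ᶠ b → (a′ , b′) ∈ᶜ cells

open YoungDiagram public

IsFilling : YoungDiagram n m → CellSet n m → Set
IsFilling D F =
    (∀ i j → (i , j) ∈ᶜ F → (i , j) ∈ᶜ cells D)
  × (∀ i j j′ → (i , j) ∈ᶜ F → (i , j′) ∈ᶜ F → j ≡ j′)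
  × (∀ i i′ j → (i , j) ∈ᶜ F → (i′ , j) ∈ᶜ F → i ≡ i′)

Consecutive : Vec (Fin n) k → Set
Consecutive i = ∀ p q → toℕ q ≡ suc (toℕ p) → toℕ (lookup i q) ≡ suc (toℕ (lookup i p))

-- r lists the rows π(i₁), …, π(iₖ) of the selected cells in the columns i₁, …, iₖ.
Occurrence : YoungDiagram n m → CellSet n m → Pattern k → Vec (Fin n) k → Vec (Fin m) k → Set
Occurrence D F σ i r =
    Consecutive i
  × (∀ p → (lookup i p , lookup r p) ∈ᶜ F)
  × (map toℕ r ∼ word σ)
  × (∀ p q → (lookup i p , lookup r q) ∈ᶜ cells D)

Contains : YoungDiagram n m → CellSet n m → Pattern k → Set
Contains D F σ = ∃[ i ] ∃[ r ] Occurrence D F σ i r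

Avoids : YoungDiagram n m → CellSet n m → Pattern k → Set
Avoids D F σ = ¬ Contains D F σ

EmptyRowsAre : CellSet n m → Subset m → Set
EmptyRowsAre F R = ∀ j → j ∈ R ⇔ (¬ (∃[ i ] (i , j) ∈ᶜ F))

EmptyColumnsAre : CellSet n m → Subset n → Set
EmptyColumnsAre F C = ∀ i → i ∈ C ⇔ (¬ (∃[ j ] (i , j) ∈ᶜ F))

Counted : YoungDiagram n m → Subset m → Subset n → Pattern k → CellSet n m → Set
Counted D R C σ F = IsFilling D F × Avoids D F σ × EmptyRowsAre F R × EmptyColumnsAre F C

_⇔?_ : {A B : Set} → Dec A → Dec B → Dec (A ⇔ B)
a? ⇔? b? = map′ (uncurry mk⇔) (λ e → Equivalence.to e , Equivalence.from e)
                ((a? →-dec b?) ×-dec (b? →-dec a?))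

anyVec? : {P : Vec (Fin n) k → Set} → Decidable P → Dec (∃ P)
anyVec? {k = zero}  P? = map′ ([] ,_) (λ { ([] , p) → p }) (P? [])
anyVec? {k = suc k} P? =
  map′ (λ { (x , xs , p) → x ∷ xs , p }) (λ { (x ∷ xs , p) → x , xs , p })
       (Fin.any? λ x → anyVec? λ xs → P? (x ∷ xs))

_∈ᶜ?_ : (c : Fin n × Fin m) (S : CellSet n m) → Dec (c ∈ᶜ S)
(i , j) ∈ᶜ? S = j ∈? lookup S i

isFilling? : (D : YoungDiagram n m) → Decidable (IsFilling D)
isFilling? D F =
  (Fin.all? λ i → Fin.all? λ j → ((i , j) ∈ᶜ? F) →-dec ((i , j) ∈ᶜ? cells D))
  ×-dec (Fin.all? λ i → Fin.all? λ j → Fin.all? λ j′ →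
           ((i , j) ∈ᶜ? F) →-dec (((i , j′) ∈ᶜ? F) →-dec (j Fin.≟ j′)))
  ×-dec (Fin.all? λ i → Fin.all? λ i′ → Fin.all? λ j →
           ((i , j) ∈ᶜ? F) →-dec (((i′ , j) ∈ᶜ? F) →-dec (i Fin.≟ i′)))

occurrence? : (D : YoungDiagram n m) (F : CellSet n m) (σ : Pattern k) →
              ∀ i r → Dec (Occurrence D F σ i r)
occurrence? D F σ i r =
  (Fin.all? λ p → Fin.all? λ q →
     (toℕ q ℕ.≟ suc (toℕ p)) →-dec (toℕ (lookup i q) ℕ.≟ suc (toℕ (lookup i p))))
  ×-dec (Fin.all? λ p → (lookup i p , lookup r p) ∈ᶜ? F)
  ×-dec (Fin.all? λ p → Fin.all? λ q →
           (lookup (map toℕ r) p ℕ.<? lookup (map toℕ r) q)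
           ⇔? (lookup (word σ) p ℕ.<? lookup (word σ) q))
  ×-dec (Fin.all? λ p → Fin.all? λ q → (lookup i p , lookup r q) ∈ᶜ? cells D)

counted? : (D : YoungDiagram n m) (R : Subset m) (C : Subset n) (σ : Pattern k) →
           Decidable (Counted D R C σ)
counted? D R C σ F =
  isFilling? D F
  ×-dec ¬? (anyVec? λ i → anyVec? λ r → occurrence? D F σ i r)
  ×-dec (Fin.all? λ j → (j ∈? R) ⇔? ¬? (Fin.any? λ i → (i , j) ∈ᶜ? F))
  ×-dec (Fin.all? λ i → (i ∈? C) ⇔? ¬? (Fin.any? λ j → (i , j) ∈ᶜ? F))

-- If xs lists every element of A exactly once, then allVecs xs n lists every
-- element of Vec A n exactly once.
allVecs : {A : Set} → List A → (n : ℕ) → List (Vec A n)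
allVecs xs zero    = [] ∷ []
allVecs xs (suc n) = cartesianProductWith _∷_ xs (allVecs xs n)

allCellSets : ∀ n m → List (CellSet n m)
allCellSets n m = allVecs (allVecs (outside ∷ inside ∷ []) m) n

#avoiding : YoungDiagram n m → Subset m → Subset n → Pattern k → ℕ
#avoiding {n} {m} D R C σ = length (filter (counted? D R C σ) (allCellSets n m))

infix 4 _≡fs_

_≡fs_ : Pattern k → Pattern l → Set
σ ≡fs τ = ∀ {n m} (D : YoungDiagram n m) (R : Subset m) (C : Subset n) →
          #avoiding D R C σ ≡ #avoiding D R C τ

-- Sorting each word below evaluates to 1, …, 4.
open SortingAlgorithm mergeSort using (sort-↭)

p1342 : Pattern 4
p1342 = record
  { word = 1 ∷ 3 ∷ 4 ∷ 2 ∷ [] ; isPermutation = ↭-sym (sort-↭ (1 ∷ 3 ∷ 4 ∷ 2 ∷ [])) }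

p1432 : Pattern 4
p1432 = record
  { word = 1 ∷ 4 ∷ 3 ∷ 2 ∷ [] ; isPermutation = ↭-sym (sort-↭ (1 ∷ 4 ∷ 3 ∷ 2 ∷ [])) }

p2341 : Pattern 4
p2341 = record
  { word = 2 ∷ 3 ∷ 4 ∷ 1 ∷ [] ; isPermutation = ↭-sym (sort-↭ (2 ∷ 3 ∷ 4 ∷ 1 ∷ [])) }

p2431 : Pattern 4
p2431 = record
  { word = 2 ∷ 4 ∷ 3 ∷ 1 ∷ [] ; isPermutation = ↭-sym (sort-↭ (2 ∷ 4 ∷ 3 ∷ 1 ∷ [])) }

p4213 : Pattern 4
p4213 = record
  { word = 4 ∷ 2 ∷ 1 ∷ 3 ∷ [] ; isPermutation = ↭-sym (sort-↭ (4 ∷ 2 ∷ 1 ∷ 3 ∷ [])) }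

p4123 : Pattern 4
p4123 = record
  { word = 4 ∷ 1 ∷ 2 ∷ 3 ∷ [] ; isPermutation = ↭-sym (sort-↭ (4 ∷ 1 ∷ 2 ∷ 3 ∷ [])) }

p3214 : Pattern 4
p3214 = record
  { word = 3 ∷ 2 ∷ 1 ∷ 4 ∷ [] ; isPermutation = ↭-sym (sort-↭ (3 ∷ 2 ∷ 1 ∷ 4 ∷ [])) }

p3124 : Pattern 4
p3124 = record
  { word = 3 ∷ 1 ∷ 2 ∷ 4 ∷ [] ; isPermutation = ↭-sym (sort-↭ (3 ∷ 1 ∷ 2 ∷ 4 ∷ [])) }

{-# OPTIONS --safe #-}
module Submission where

-- In each of the four pairs σ, τ the word of τ is that of σ with the two middle
-- letters exchanged, and both middle letters are larger than both end letters
-- (or both smaller).  Hence two occurrences of σ or τ in a filling share at most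
-- one column, an end column of both.  So the middle columns of all the occurrences
-- of σ or τ can be exchanged simultaneously: this turns the occurrences of σ into
-- occurrences of τ and conversely, creates no others, and is an involution.

open import Defs
open import Data.Bool.Properties using () renaming (_≟_ to _≟ᵇ_)
open import Data.Empty using (⊥)
open import Data.Fin.Base using (Fin; zero; suc; toℕ)
import Data.Fin.Properties as Fin
open import Data.Fin.Patterns using (0F; 1F; 2F; 3F)
open import Data.Fin.Permutation as Perm using (Permutation′; lift₀; _⟨$⟩ʳ_; _⟨$⟩ˡ_)
open import Data.Fin.Subset using (Subset; _∈_; _⊆_; ⁅_⁆; Nonempty; inside; outside)
open import Data.Fin.Subset.Properties using (_∈?_; x∈⁅x⁆; x∈⁅y⁆⇒x≡y; ⊆-antisym)
open import Data.List.Base as List using (List; []; _∷_; filter; length)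
import Data.List.Membership.Propositional as List
open import Data.List.Membership.Propositional.Properties
  using (∈-map⁺; ∈-map⁻; ∈-filter⁺; ∈-filter⁻; ∈-cartesianProductWith⁺)
open import Data.List.Membership.Propositional.Properties.WithK using (unique∧set⇒bag)
open import Data.List.Relation.Binary.BagAndSetEquality using (∼bag⇒↭)
open import Data.List.Relation.Binary.Permutation.Propositional.Properties using (↭-length)
open import Data.List.Properties using (length-map)
open import Data.List.Relation.Unary.All using ([]; _∷_)
open import Data.List.Relation.Unary.AllPairs using ([]; _∷_)
open import Data.List.Relation.Unary.Any using (here; there)
open import Data.List.Relation.Unary.Unique.Propositional using (Unique)
import Data.List.Relation.Unary.Unique.Propositional.Properties as Unique
open import Data.Nat.Base using (ℕ; zero; suc; _<_; _>_)
import Data.Nat.Properties as ℕ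
open import Data.Product.Base using (_×_; _,_; ∃; proj₁; proj₂)
open import Data.Sum.Base using (_⊎_; inj₁; inj₂; [_,_])
open import Data.Vec.Base using (Vec; []; _∷_; lookup; map)
open import Data.Vec.Properties using (≡-dec; ∷-injective; lookup-map; map-∘)
open import Function.Base using (_∘_; id)
open import Function.Bundles using (_⇔_; mk⇔; module Equivalence)
open import Level using (0ℓ)
open import Relation.Binary.Core using (Rel)
open import Relation.Binary.Definitions using (Asymmetric)
open import Relation.Binary.PropositionalEquality
  using (_≡_; refl; sym; trans; cong; cong₂; subst; subst₂; module ≡-Reasoning)
open import Relation.Nullary.Decidable using (Dec; yes; no; map′; _×-dec_; _⊎-dec_; from-yes)
open import Relation.Nullary.Negation using (¬_; contradiction)
open import Relation.Unary using (Decidable)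

open Equivalence using (to; from)

private
  variable
    A B : Set
    n m : ℕ

-- Counting

module _ {P Q : A → Set} (P? : Decidable P) (Q? : Decidable Q) {xs : List A}
         (unique : Unique xs) (complete : ∀ x → x List.∈ xs)
         (φ : A → A) (φ-involutive : ∀ x → φ (φ x) ≡ x)
         (P⇒Q : ∀ {x} → P x → Q (φ x)) (Q⇒P : ∀ {x} → Q x → P (φ x)) where

  -- The `φ`-image of the elements satisfying `P` and the list of those satisfying `Q` are both
  -- duplicate-free and have the same members, hence are permutations of each other.
  length-filter-involution : length (filter P? xs) ≡ length (filter Q? xs)
  length-filter-involution = begin
    length (filter P? xs)               ≡⟨ length-map φ (filter P? xs) ⟨
    length (List.map φ (filter P? xs))  ≡⟨ ↭-length (∼bag⇒↭ (unique∧set⇒bag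
                                             (Unique.map⁺ φ-injective (Unique.filter⁺ P? unique))
                                             (Unique.filter⁺ Q? unique)
                                             (mk⇔ image⊆ ⊆image))) ⟩
    length (filter Q? xs)               ∎
    where
    open ≡-Reasoning

    φ-injective : ∀ {x y} → φ x ≡ φ y → x ≡ y
    φ-injective {x} {y} eq = trans (sym (φ-involutive x)) (trans (cong φ eq) (φ-involutive y))

    image⊆ : ∀ {y} → y List.∈ List.map φ (filter P? xs) → y List.∈ filter Q? xs
    image⊆ y∈ with x , x∈ , refl ← ∈-map⁻ φ y∈ =
      ∈-filter⁺ Q? (complete _) (P⇒Q (proj₂ (∈-filter⁻ P? {xs = xs} x∈)))

    ⊆image : ∀ {y} → y List.∈ filter Q? xs → y List.∈ List.map φ (filter P? xs)
    ⊆image {y} y∈ = subst (List._∈ _) (φ-involutive y)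
      (∈-map⁺ φ (∈-filter⁺ P? (complete _) (Q⇒P (proj₂ (∈-filter⁻ Q? {xs = xs} y∈)))))

allVecs-unique : {xs : List A} → Unique xs → ∀ n → Unique (allVecs xs n)
allVecs-unique xs! zero    = [] ∷ []
allVecs-unique xs! (suc n) =
  Unique.cartesianProductWith⁺ _∷_ ∷-injective xs! (allVecs-unique xs! n)

∈-allVecs : {xs : List A} → (∀ x → x List.∈ xs) → (v : Vec A n) → v List.∈ allVecs xs n
∈-allVecs ∈xs []      = here refl
∈-allVecs ∈xs (x ∷ v) = ∈-cartesianProductWith⁺ _∷_ (∈xs x) (∈-allVecs ∈xs v)

allCellSets-unique : Unique (allCellSets n m)
allCellSets-unique {n} {m} =
  allVecs-unique (allVecs-unique (((λ ()) ∷ []) ∷ [] ∷ []) m) n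

∈-allCellSets : (F : CellSet n m) → F List.∈ allCellSets n m
∈-allCellSets = ∈-allVecs (∈-allVecs λ { outside → here refl ; inside → there (here refl) })

-- Exchanging the middle columns of disjoint windows

swapMiddle : Vec A 4 → Vec A 4
swapMiddle (a ∷ b ∷ c ∷ d ∷ []) = a ∷ c ∷ b ∷ d ∷ []

-- A property of four adjacent columns of a diagram and of a cell set inside it.
Window : Set → Set → Set₁
Window B A = Vec B 4 → Vec A 4 → Set

data Begins (X : Window B A) : Vec B n → Vec A n → Set where
  begins : ∀ {d₀ d₁ d₂ d₃ c₀ c₁ c₂ c₃} {ds : Vec B n} {cs : Vec A n} →
           X (d₀ ∷ d₁ ∷ d₂ ∷ d₃ ∷ []) (c₀ ∷ c₁ ∷ c₂ ∷ c₃ ∷ []) →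
           Begins X (d₀ ∷ d₁ ∷ d₂ ∷ d₃ ∷ ds) (c₀ ∷ c₁ ∷ c₂ ∷ c₃ ∷ cs)

-- The position is given recursively instead of by an index, so that an occurrence can be followed
-- along the scan recorded by `Swapped`.
data Occurs (X : Window B A) : Vec B n → Vec A n → Set where
  here  : {ds : Vec B n} {cs : Vec A n} → Begins X ds cs → Occurs X ds cs
  there : ∀ {d c} {ds : Vec B n} {cs : Vec A n} → Occurs X ds cs → Occurs X (d ∷ ds) (c ∷ cs)

begins? : {X : Window B A} → (∀ ds cs → Dec (X ds cs)) →
          (ds : Vec B n) (cs : Vec A n) → Dec (Begins X ds cs)
begins? X? []               _ = no λ ()
begins? X? (_ ∷ [])         _ = no λ ()
begins? X? (_ ∷ _ ∷ [])     _ = no λ ()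
begins? X? (_ ∷ _ ∷ _ ∷ []) _ = no λ ()
begins? X? (d₀ ∷ d₁ ∷ d₂ ∷ d₃ ∷ _) (c₀ ∷ c₁ ∷ c₂ ∷ c₃ ∷ _)
  with X? (d₀ ∷ d₁ ∷ d₂ ∷ d₃ ∷ []) (c₀ ∷ c₁ ∷ c₂ ∷ c₃ ∷ [])
... | yes x = yes (begins x)
... | no ¬x = no λ { (begins x) → ¬x x }

SwapInvariant : Window B A → Set
SwapInvariant W = ∀ {ds cs} → W ds cs → W ds (swapMiddle cs)

-- A shift by three is permitted: the shared column is then an end of both windows, which no
-- exchange moves. `ds` and `ds′` are unrelated because the clash will come from the selected rows
-- alone.
record NonOverlapping (W : Window B A) : Set where
  field
    shift₁ : ∀ {ds ds′ a b c d e} → W ds (a ∷ b ∷ c ∷ d ∷ []) → W ds′ (b ∷ c ∷ d ∷ e ∷ []) → ⊥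
    shift₂ : ∀ {ds ds′ a b c d e f} → W ds (a ∷ b ∷ c ∷ d ∷ []) → W ds′ (c ∷ d ∷ e ∷ f ∷ []) → ⊥

-- Swapped W ds cs cs′: scanning from the left, the middle columns of each window
-- satisfying W are exchanged, and the scan resumes at the last column of the window.
data Swapped (W : Window B A) : Vec B n → Vec A n → Vec A n → Set where
  nil  : Swapped W [] [] []
  keep : ∀ {d c} {ds : Vec B n} {cs cs′ : Vec A n} →
         ¬ Begins W (d ∷ ds) (c ∷ cs) → Swapped W ds cs cs′ →
         Swapped W (d ∷ ds) (c ∷ cs) (c ∷ cs′)
  swap : ∀ {d₀ d₁ d₂ d₃ c₀ c₁ c₂ c₃} {ds : Vec B n} {cs cs′ : Vec A n} →
         W (d₀ ∷ d₁ ∷ d₂ ∷ d₃ ∷ []) (c₀ ∷ c₁ ∷ c₂ ∷ c₃ ∷ []) →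
         Swapped W (d₃ ∷ ds) (c₃ ∷ cs) (c₃ ∷ cs′) →
         Swapped W (d₀ ∷ d₁ ∷ d₂ ∷ d₃ ∷ ds) (c₀ ∷ c₁ ∷ c₂ ∷ c₃ ∷ cs) (c₀ ∷ c₂ ∷ c₁ ∷ c₃ ∷ cs′)

module _ {W : Window B A} where

  Swapped-functional : {ds : Vec B n} {cs cs′ cs″ : Vec A n} →
                       Swapped W ds cs cs′ → Swapped W ds cs cs″ → cs′ ≡ cs″
  Swapped-functional nil         nil          = refl
  Swapped-functional (keep _ s)  (keep _ s′)  = cong (_ ∷_) (Swapped-functional s s′)
  Swapped-functional (keep ¬w _) (swap w _)   = contradiction (begins w) ¬w
  Swapped-functional (swap w _)  (keep ¬w _)  = contradiction (begins w) ¬w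
  Swapped-functional (swap _ s)  (swap _ s′)
    with refl ← Swapped-functional s s′ = refl

  module _ (W? : ∀ ds cs → Dec (W ds cs)) where

    swapWindows-total : (ds : Vec B n) (cs : Vec A n) → ∃ (Swapped W ds cs)

    -- The result is forced to start with `c` because `swap` resumes at the last column of a window
    -- and requires that column to come out unchanged.
    swapWindows-from : (d : B) (ds : Vec B n) (c : A) (cs : Vec A n) →
                       ∃ λ cs′ → Swapped W (d ∷ ds) (c ∷ cs) (c ∷ cs′)
    swapWindows-from d ds c cs with begins? W? (d ∷ ds) (c ∷ cs)
    swapWindows-from d ds c cs | no ¬w
      with cs′ , s ← swapWindows-total ds cs = cs′ , keep ¬w s
    swapWindows-from d (_ ∷ _ ∷ d₃ ∷ ds) c (c₁ ∷ c₂ ∷ c₃ ∷ cs) | yes (begins w)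
      with cs′ , s ← swapWindows-from d₃ ds c₃ cs = c₂ ∷ c₁ ∷ c₃ ∷ cs′ , swap w s

    swapWindows-total []       []       = [] , nil
    swapWindows-total (d ∷ ds) (c ∷ cs) with cs′ , s ← swapWindows-from d ds c cs = c ∷ cs′ , s

  -- Successive exchanged windows share at most an end column, so every column is either unchanged
  -- or moved by exactly one exchange.
  Swapped-pointwise : {R : B → A → A → Set} → (∀ {b a} → R b a a) →
    (∀ {d₀ d₁ d₂ d₃ c₀ c₁ c₂ c₃} → W (d₀ ∷ d₁ ∷ d₂ ∷ d₃ ∷ []) (c₀ ∷ c₁ ∷ c₂ ∷ c₃ ∷ []) →
       R d₁ c₁ c₂ × R d₂ c₂ c₁) →
    {ds : Vec B n} {cs cs′ : Vec A n} → Swapped W ds cs cs′ →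
    ∀ i → R (lookup ds i) (lookup cs i) (lookup cs′ i)
  Swapped-pointwise R-refl R-swap (keep _ s) zero          = R-refl
  Swapped-pointwise R-refl R-swap (keep _ s) (suc i)       = Swapped-pointwise R-refl R-swap s i
  Swapped-pointwise R-refl R-swap (swap w s) 0F            = R-refl
  Swapped-pointwise R-refl R-swap (swap w s) 1F            = proj₁ (R-swap w)
  Swapped-pointwise R-refl R-swap (swap w s) 2F            = proj₂ (R-swap w)
  Swapped-pointwise R-refl R-swap (swap w s) (suc (suc (suc i))) =
    Swapped-pointwise R-refl R-swap s i

  Swapped-permutes : {ds : Vec B n} {cs cs′ : Vec A n} → Swapped W ds cs cs′ →
                     ∃ λ (π : Permutation′ n) → ∀ i → lookup cs′ i ≡ lookup cs (π ⟨$⟩ʳ i)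
  Swapped-permutes nil = Perm.id , λ ()
  Swapped-permutes (keep _ s) with π , eq ← Swapped-permutes s =
    lift₀ π , λ { zero → refl ; (suc i) → eq i }
  Swapped-permutes (swap _ s) with π , eq ← Swapped-permutes s =
    -- `lift₀` fixes the first column of the window, `Perm.swap` exchanges the next two, and `π`
    -- acts from the last column of the window onwards.
    lift₀ (Perm.swap π) ,
    λ { 0F → refl ; 1F → refl ; 2F → refl ; (suc (suc (suc i))) → eq i }

  module _ (W-swap : SwapInvariant W) (disjoint : NonOverlapping W) where
    open NonOverlapping disjoint

    -- A window starting at `c` meets only the first three columns of the tail. An exchange starting
    -- at the first or second of them would overlap it, and one starting at the third leaves that
    -- column in place.
    begins-unswapped : ∀ {d c} {ds : Vec B n} {cs cs′ : Vec A n} {X : Window B A} →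
                       (∀ {ds cs} → X ds cs → W ds cs) →
                       Swapped W ds cs cs′ → Begins X (d ∷ ds) (c ∷ cs′) → Begins X (d ∷ ds) (c ∷ cs)
    begins-unswapped X⇒W (swap w _) (begins x) with () ← shift₁ (X⇒W x) (W-swap w)
    begins-unswapped X⇒W (keep _ (swap w _)) (begins x) with () ← shift₂ (X⇒W x) (W-swap w)
    begins-unswapped X⇒W (keep _ (keep _ (keep _ _))) (begins x) = begins x
    begins-unswapped X⇒W (keep _ (keep _ (swap _ _))) (begins x) = begins x

    -- A second scan makes the same choices: exchanged windows still satisfy `W`, and by
    -- `begins-unswapped` no window begins at a kept column that did not begin there before.
    Swapped-sym : {ds : Vec B n} {cs cs′ : Vec A n} → Swapped W ds cs cs′ → Swapped W ds cs′ cs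
    Swapped-sym nil         = nil
    Swapped-sym (keep ¬w s) = keep (¬w ∘ begins-unswapped id s) (Swapped-sym s)
    Swapped-sym (swap w s)  = swap (W-swap w) (Swapped-sym s)

    -- An `X`-window in the result must coincide with an exchanged window: at a kept column it would
    -- already have been present in `cs`, and `¬w` excludes that. Undoing the exchange there yields
    -- `Y`.
    occurs-unswapped : {X Y : Window B A} → (∀ {ds cs} → X ds cs → W ds cs) →
                       (∀ {ds cs} → X ds cs → Y ds (swapMiddle cs)) →
                       {ds : Vec B n} {cs cs′ : Vec A n} → Swapped W ds cs cs′ →
                       Occurs X ds cs′ → Occurs Y ds cs
    occurs-unswapped X⇒W X⇒Y (keep ¬w s) (here x)
      with begins x′ ← begins-unswapped X⇒W s x = contradiction (begins (X⇒W x′)) ¬w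
    occurs-unswapped X⇒W X⇒Y (keep _ s) (there o) = there (occurs-unswapped X⇒W X⇒Y s o)
    occurs-unswapped X⇒W X⇒Y (swap _ _) (here (begins x)) = here (begins (X⇒Y x))
    -- Starting at the second or third column of an exchanged window would overlap it.
    occurs-unswapped X⇒W X⇒Y (swap w _) (there (here (begins x)))
      with () ← shift₁ (W-swap w) (X⇒W x)
    occurs-unswapped X⇒W X⇒Y (swap w _) (there (there (here (begins x))))
      with () ← shift₂ (W-swap w) (X⇒W x)
    -- From the fourth column on, the occurrence lies in the part where the scan resumed.
    occurs-unswapped X⇒W X⇒Y (swap _ s) (there (there (there o))) =
      there (there (there (occurs-unswapped X⇒W X⇒Y s o)))

-- Occurrences at indices

consecutive : {i₀ i₁ i₂ i₃ : Fin n} →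
              toℕ i₁ ≡ suc (toℕ i₀) → toℕ i₂ ≡ suc (toℕ i₁) → toℕ i₃ ≡ suc (toℕ i₂) →
              Consecutive (i₀ ∷ i₁ ∷ i₂ ∷ i₃ ∷ [])
consecutive e₀ e₁ e₂ 0F 1F refl = e₀
consecutive e₀ e₁ e₂ 1F 2F refl = e₁
consecutive e₀ e₁ e₂ 2F 3F refl = e₂

consecutive-suc : ∀ {k} (i : Vec (Fin n) k) → Consecutive i → Consecutive (map Fin.suc i)
consecutive-suc i con p q eq
  rewrite lookup-map p Fin.suc i | lookup-map q Fin.suc i = cong suc (con p q eq)

module _ {X : Window B A} where

  occurs⇒consecutive : {ds : Vec B n} {cs : Vec A n} → Occurs X ds cs →
    ∃ λ (i : Vec (Fin n) 4) → Consecutive i × X (map (lookup ds) i) (map (lookup cs) i)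
  occurs⇒consecutive (here (begins x)) =
    0F ∷ 1F ∷ 2F ∷ 3F ∷ [] , consecutive refl refl refl , x
  occurs⇒consecutive (there {d = d} {c} {ds} {cs} o) with i , con , x ← occurs⇒consecutive o =
    map Fin.suc i , consecutive-suc i con ,
    subst₂ X (map-∘ (lookup (d ∷ ds)) Fin.suc i) (map-∘ (lookup (c ∷ cs)) Fin.suc i) x

  consecutive⇒occurs : {ds : Vec B n} {cs : Vec A n} (i : Vec (Fin n) 4) → Consecutive i →
                       X (map (lookup ds) i) (map (lookup cs) i) → Occurs X ds cs
  consecutive⇒occurs {ds = ds} {cs} (i₀ ∷ i₁ ∷ i₂ ∷ i₃ ∷ []) con =
    go i₀ i₁ i₂ i₃ ds cs (con 0F 1F refl) (con 1F 2F refl) (con 2F 3F refl)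
    where
    go : ∀ {n} (i₀ i₁ i₂ i₃ : Fin n) (ds : Vec B n) (cs : Vec A n) →
         toℕ i₁ ≡ suc (toℕ i₀) → toℕ i₂ ≡ suc (toℕ i₁) → toℕ i₃ ≡ suc (toℕ i₂) →
         X (map (lookup ds) (i₀ ∷ i₁ ∷ i₂ ∷ i₃ ∷ [])) (map (lookup cs) (i₀ ∷ i₁ ∷ i₂ ∷ i₃ ∷ [])) →
         Occurs X ds cs
    go 0F 1F 2F 3F (_ ∷ _ ∷ _ ∷ _ ∷ _) (_ ∷ _ ∷ _ ∷ _ ∷ _) refl refl refl x = here (begins x)
    go (suc i₀) (suc i₁) (suc i₂) (suc i₃) (_ ∷ ds) (_ ∷ cs) e₀ e₁ e₂ x =
      there (go i₀ i₁ i₂ i₃ ds cs (ℕ.suc-injective e₀) (ℕ.suc-injective e₁) (ℕ.suc-injective e₂) x)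

-- Pattern windows

-- The columns are required to be singletons, so that they determine the rows r;
-- in a filling this is no restriction.
record PatternWindow (σ : Pattern 4) (ds cs : Vec (Subset m) 4) : Set where
  constructor window
  field
    r    : Vec (Fin m) 4
    cs≡r : cs ≡ map ⁅_⁆ r
    r∼σ  : map toℕ r ∼ word σ
    rect : ∀ p q → lookup r q ∈ lookup ds p

patternWindow? : (σ : Pattern 4) (ds cs : Vec (Subset m) 4) → Dec (PatternWindow σ ds cs)
patternWindow? σ ds cs =
  map′ (λ (r , cs≡r , r∼σ , rect) → window r cs≡r r∼σ rect)
       (λ (window r cs≡r r∼σ rect) → r , cs≡r , r∼σ , rect)
       (anyVec? λ r →
          ≡-dec (≡-dec _≟ᵇ_) cs (map ⁅_⁆ r)
          ×-dec (Fin.all? λ p → Fin.all? λ q →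
                   (lookup (map toℕ r) p ℕ.<? lookup (map toℕ r) q)
                   ⇔? (lookup (word σ) p ℕ.<? lookup (word σ) q))
          ×-dec (Fin.all? λ p → Fin.all? λ q → lookup r q ∈? lookup ds p))

UniqueRows : CellSet n m → Set
UniqueRows F = ∀ i j j′ → (i , j) ∈ᶜ F → (i , j′) ∈ᶜ F → j ≡ j′

column≡singleton : (F : CellSet n m) → UniqueRows F → ∀ {i j} → (i , j) ∈ᶜ F → lookup F i ≡ ⁅ j ⁆
column≡singleton F uniq {i} {j} j∈ = ⊆-antisym
  (λ j′∈ → subst (λ j → _ ∈ ⁅ j ⁆) (uniq _ _ _ j′∈ j∈) (x∈⁅x⁆ _))
  (λ j′∈ → subst (_∈ lookup F i) (sym (x∈⁅y⁆⇒x≡y j j′∈)) j∈)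

columns≡singletons : ∀ {k} (F : CellSet n m) → UniqueRows F →
                     (i : Vec (Fin n) k) (r : Vec (Fin m) k) →
                     (∀ p → (lookup i p , lookup r p) ∈ᶜ F) → map (lookup F) i ≡ map ⁅_⁆ r
columns≡singletons F uniq []       []       _  = refl
columns≡singletons F uniq (i ∷ is) (r ∷ rs) r∈ =
  cong₂ _∷_ (column≡singleton F uniq (r∈ zero)) (columns≡singletons F uniq is rs (r∈ ∘ suc))

module _ (D : YoungDiagram n m) (σ : Pattern 4) {F : CellSet n m} where

  contains⇒occurs : UniqueRows F → Contains D F σ → Occurs (PatternWindow σ) (cells D) F
  contains⇒occurs uniq (i , r , con , r∈ , r∼σ , rect) = consecutive⇒occurs i con
    (window r (columns≡singletons F uniq i r r∈) r∼σ λ p q →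
       subst (lookup r q ∈_) (sym (lookup-map p (lookup (cells D)) i)) (rect p q))

  occurs⇒contains : Occurs (PatternWindow σ) (cells D) F → Contains D F σ
  occurs⇒contains o with i , con , window r eq r∼σ rect ← occurs⇒consecutive o =
    i , r , con , r∈ , r∼σ ,
    λ p q → subst (lookup r q ∈_) (lookup-map p (lookup (cells D)) i) (rect p q)
    where
    r∈ : ∀ p → (lookup i p , lookup r p) ∈ᶜ F
    r∈ p = subst (lookup r p ∈_) column (x∈⁅x⁆ _)
      where
      open ≡-Reasoning
      column : ⁅ lookup r p ⁆ ≡ lookup F (lookup i p)
      column = begin
        ⁅ lookup r p ⁆             ≡⟨ lookup-map p ⁅_⁆ r ⟨
        lookup (map ⁅_⁆ r) p        ≡⟨ cong (λ v → lookup v p) eq ⟨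
        lookup (map (lookup F) i) p ≡⟨ lookup-map p (lookup F) i ⟩
        lookup F (lookup i p)       ∎

-- Patterns differing by the exchange of their middle letters

swapMiddle-involutive : (v : Vec A 4) → swapMiddle (swapMiddle v) ≡ v
swapMiddle-involutive (_ ∷ _ ∷ _ ∷ _ ∷ []) = refl

map-swapMiddle : (f : A → B) (v : Vec A 4) → map f (swapMiddle v) ≡ swapMiddle (map f v)
map-swapMiddle f (_ ∷ _ ∷ _ ∷ _ ∷ []) = refl

middle : Fin 4 → Fin 4
middle 0F = 0F
middle 1F = 2F
middle 2F = 1F
middle 3F = 3F

lookup-swapMiddle : (v : Vec A 4) (p : Fin 4) → lookup (swapMiddle v) p ≡ lookup v (middle p)
lookup-swapMiddle (_ ∷ _ ∷ _ ∷ _ ∷ []) 0F = refl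
lookup-swapMiddle (_ ∷ _ ∷ _ ∷ _ ∷ []) 1F = refl
lookup-swapMiddle (_ ∷ _ ∷ _ ∷ _ ∷ []) 2F = refl
lookup-swapMiddle (_ ∷ _ ∷ _ ∷ _ ∷ []) 3F = refl

swapMiddle-∼ : (v w : Vec ℕ 4) → v ∼ w → swapMiddle v ∼ swapMiddle w
swapMiddle-∼ v w v∼w p q
  rewrite lookup-swapMiddle v p | lookup-swapMiddle v q
        | lookup-swapMiddle w p | lookup-swapMiddle w q = v∼w (middle p) (middle q)

-- `rect` ranges over all pairs of a column and a row of the window, so it survives any
-- rearrangement of the rows while `ds` stays fixed.
patternWindow-swap : {σ τ : Pattern 4} → word τ ≡ swapMiddle (word σ) →
                     ∀ {ds cs : Vec (Subset m) 4} →
                     PatternWindow σ ds cs → PatternWindow τ ds (swapMiddle cs)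
patternWindow-swap {σ = σ} eq {ds} (window r refl r∼σ rect) = window
  (swapMiddle r)
  (sym (map-swapMiddle ⁅_⁆ r))
  (subst₂ _∼_ (sym (map-swapMiddle toℕ r)) (sym eq) (swapMiddle-∼ (map toℕ r) (word σ) r∼σ))
  (λ p q → subst (_∈ lookup ds p) (sym (lookup-swapMiddle r q)) (rect p (middle q)))

singleton-injective : {x y : Fin n} → ⁅ x ⁆ ≡ ⁅ y ⁆ → x ≡ y
singleton-injective {x = x} {y} eq = x∈⁅y⁆⇒x≡y y (subst (x ∈_) eq (x∈⁅x⁆ x))

-- The relation is a parameter so that large middle letters (`_<_`) and small ones (`_>_`) are
-- treated together.
EndsBefore : Rel ℕ 0ℓ → Vec ℕ 4 → Set
EndsBefore _≺_ (a ∷ b ∷ c ∷ d ∷ []) = (a ≺ b × a ≺ c) × (d ≺ b × d ≺ c)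

module _ {_≺_ : Rel ℕ 0ℓ} where

  endsBefore-swapMiddle : ∀ w → EndsBefore _≺_ w → EndsBefore _≺_ (swapMiddle w)
  endsBefore-swapMiddle (_ ∷ _ ∷ _ ∷ _ ∷ []) ((ab , ac) , (db , dc)) = (ac , ab) , (dc , db)

  module _ (≺-asym : Asymmetric _≺_)
           (∼-reflects : ∀ (v w : Vec ℕ 4) → v ∼ w →
                         ∀ p q → lookup w p ≺ lookup w q → lookup v p ≺ lookup v q) where

    ∼-endsBefore : (v w : Vec ℕ 4) → v ∼ w → EndsBefore _≺_ w → EndsBefore _≺_ v
    ∼-endsBefore v@(_ ∷ _ ∷ _ ∷ _ ∷ []) w@(_ ∷ _ ∷ _ ∷ _ ∷ []) v∼w ((ab , ac) , (db , dc)) =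
      (∼-reflects v w v∼w 0F 1F ab , ∼-reflects v w v∼w 0F 2F ac) ,
      (∼-reflects v w v∼w 3F 1F db , ∼-reflects v w v∼w 3F 2F dc)

    -- Under a shift by one or two, the last column of the left window is a middle column of the
    -- right one, and the first column of the right window is a middle column of the left one. The
    -- rows of these two columns would then compare in both directions.
    endsBefore-nonOverlapping : {W : Window (Subset m) (Subset m)} →
      (∀ {ds cs} → W ds cs → ∃ λ σ → EndsBefore _≺_ (word σ) × PatternWindow σ ds cs) →
      NonOverlapping W
    endsBefore-nonOverlapping {m} {W} W⇒ = record { shift₁ = shift₁ ; shift₂ = shift₂ }
      where
      rows : ∀ {ds cs} → W ds cs →
             ∃ λ (r : Vec (Fin m) 4) → cs ≡ map ⁅_⁆ r × EndsBefore _≺_ (map toℕ r)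
      rows w with σ , ends , window r eq r∼σ _ ← W⇒ w = r , eq , ∼-endsBefore (map toℕ r) (word σ) r∼σ ends

      clash : {x y x′ y′ : Fin m} → ⁅ x ⁆ ≡ ⁅ x′ ⁆ → ⁅ y ⁆ ≡ ⁅ y′ ⁆ →
              toℕ x ≺ toℕ y → toℕ y′ ≺ toℕ x′ → ⊥
      clash x≡ y≡ x≺y y′≺x′
        with refl ← singleton-injective x≡ | refl ← singleton-injective y≡ = ≺-asym x≺y y′≺x′

      shift₁ : ∀ {ds ds′ a b c d e} → W ds (a ∷ b ∷ c ∷ d ∷ []) → W ds′ (b ∷ c ∷ d ∷ e ∷ []) → ⊥
      shift₁ w w′ with rows w | rows w′
      ... | _ ∷ _ ∷ _ ∷ _ ∷ [] , refl , _ , (d≺b , _) | _ ∷ _ ∷ _ ∷ _ ∷ [] , eq , (_ , b≺d) , _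
        = clash (cong (λ v → lookup v 2F) eq) (cong (λ v → lookup v 0F) eq) d≺b b≺d

      shift₂ : ∀ {ds ds′ a b c d e f} → W ds (a ∷ b ∷ c ∷ d ∷ []) → W ds′ (c ∷ d ∷ e ∷ f ∷ []) → ⊥
      shift₂ w w′ with rows w | rows w′
      ... | _ ∷ _ ∷ _ ∷ _ ∷ [] , refl , _ , (_ , d≺c) | _ ∷ _ ∷ _ ∷ _ ∷ [] , eq , (c≺d , _) , _
        = clash (cong (λ v → lookup v 1F) eq) (cong (λ v → lookup v 0F) eq) d≺c c≺d

-- Effect on fillings

module _ (D : YoungDiagram n m) {W : Window (Subset m) (Subset m)} {F F′ : CellSet n m}
         (swapped : Swapped W (cells D) F F′) where

  private
    π = proj₁ (Swapped-permutes swapped)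
    F′≡F∘π = proj₂ (Swapped-permutes swapped)

    ∈-π⁺ : ∀ {i j} → (i , j) ∈ᶜ F′ → (π ⟨$⟩ʳ i , j) ∈ᶜ F
    ∈-π⁺ {i} = subst (_ ∈_) (F′≡F∘π i)

    ∈-π⁻ : ∀ {i j} → (i , j) ∈ᶜ F → (π ⟨$⟩ˡ i , j) ∈ᶜ F′
    ∈-π⁻ {i} {j} = subst (j ∈_)
      (sym (trans (F′≡F∘π (π ⟨$⟩ˡ i)) (cong (lookup F) (Perm.inverseʳ π))))

  -- Permuting the columns leaves their union unchanged.
  swapped-emptyRows : {R : Subset m} → EmptyRowsAre F R → EmptyRowsAre F′ R
  swapped-emptyRows empty j = mk⇔
    (λ j∈R (i , ij∈) → to (empty j) j∈R (π ⟨$⟩ʳ i , ∈-π⁺ ij∈))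
    (λ ∄ → from (empty j) λ (i , ij∈) → ∄ (π ⟨$⟩ˡ i , ∈-π⁻ ij∈))

  module _ (W⇒pattern : ∀ {ds cs} → W ds cs → ∃ λ σ → PatternWindow σ ds cs) where

    private
      -- Unlike uniqueness, containment in `D` and the set of empty columns can change under a
      -- permutation of columns, so they are checked column by column. Containment is an implication
      -- so that unchanged columns satisfy it automatically.
      Compatible : Subset m → Subset m → Subset m → Set
      Compatible d c c′ = (Nonempty c ⇔ Nonempty c′) × (c ⊆ d → c′ ⊆ d)

      singletons-compatible : ∀ {d} {x y : Fin m} → y ∈ d → Compatible d ⁅ x ⁆ ⁅ y ⁆
      singletons-compatible {d} {x} {y} y∈d =
        mk⇔ (λ _ → y , x∈⁅x⁆ y) (λ _ → x , x∈⁅x⁆ x) ,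
        λ _ z∈ → subst (_∈ d) (sym (x∈⁅y⁆⇒x≡y y z∈)) y∈d

      compatible : ∀ i → Compatible (lookup (cells D) i) (lookup F i) (lookup F′ i)
      compatible = Swapped-pointwise {R = Compatible} (mk⇔ id id , id) swap-compatible swapped
        where
        swap-compatible : ∀ {d₀ d₁ d₂ d₃ c₀ c₁ c₂ c₃} →
          W (d₀ ∷ d₁ ∷ d₂ ∷ d₃ ∷ []) (c₀ ∷ c₁ ∷ c₂ ∷ c₃ ∷ []) →
          Compatible d₁ c₁ c₂ × Compatible d₂ c₂ c₁
        swap-compatible w with W⇒pattern w
        ... | _ , window (_ ∷ _ ∷ _ ∷ _ ∷ []) refl _ rect =
          singletons-compatible (rect 1F 2F) , singletons-compatible (rect 2F 1F)

    swapped-isFilling : IsFilling D F → IsFilling D F′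
    swapped-isFilling (F⊆D , uniqueRow , uniqueColumn) =
      (λ i j → proj₂ (compatible i) (F⊆D i _)) ,
      (λ i j j′ p q → uniqueRow (π ⟨$⟩ʳ i) j j′ (∈-π⁺ p) (∈-π⁺ q)) ,
      (λ i i′ j p q → π-injective (uniqueColumn _ _ j (∈-π⁺ p) (∈-π⁺ q)))
      where
      π-injective : ∀ {i i′} → π ⟨$⟩ʳ i ≡ π ⟨$⟩ʳ i′ → i ≡ i′
      π-injective eq =
        trans (sym (Perm.inverseˡ π)) (trans (cong (π ⟨$⟩ˡ_) eq) (Perm.inverseˡ π))

    swapped-emptyColumns : {C : Subset n} → EmptyColumnsAre F C → EmptyColumnsAre F′ C
    swapped-emptyColumns empty i = mk⇔
      (λ i∈C → to (empty i) i∈C ∘ from (proj₁ (compatible i)))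
      (λ ∄ → from (empty i) (∄ ∘ to (proj₁ (compatible i))))

-- The equivalence for exchanged middle letters, and its four instances

swapMiddle-≡fs : {_≺_ : Rel ℕ 0ℓ} → Asymmetric _≺_ →
  (∀ (v w : Vec ℕ 4) → v ∼ w → ∀ p q → lookup w p ≺ lookup w q → lookup v p ≺ lookup v q) →
  (σ τ : Pattern 4) → EndsBefore _≺_ (word σ) → word τ ≡ swapMiddle (word σ) → σ ≡fs τ
swapMiddle-≡fs ≺-asym ∼-reflects σ τ σ-ends τ≡σ′ {n} {m} D R C =
  length-filter-involution (counted? D R C σ) (counted? D R C τ)
    allCellSets-unique ∈-allCellSets φ
    -- Both `φ (φ F)` and `F` are results of scanning `φ F`, and the scan has only one result.
    (λ F → Swapped-functional (φ-swaps (φ F)) (Swapped-sym W-swap disjoint (φ-swaps F)))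
    (counted-swapped σ τ inj₂ (patternWindow-swap σ≡τ′))
    (counted-swapped τ σ inj₁ (patternWindow-swap τ≡σ′))
  where
  σ≡τ′ : word σ ≡ swapMiddle (word τ)
  σ≡τ′ = trans (sym (swapMiddle-involutive (word σ))) (cong swapMiddle (sym τ≡σ′))

  -- Taking the windows of both patterns makes `W` invariant under the exchange, and lets the same
  -- `φ` serve in both directions.
  W : Window (Subset m) (Subset m)
  W ds cs = PatternWindow σ ds cs ⊎ PatternWindow τ ds cs

  W? : ∀ ds cs → Dec (W ds cs)
  W? ds cs = patternWindow? σ ds cs ⊎-dec patternWindow? τ ds cs

  W-swap : SwapInvariant W
  W-swap = [ inj₂ ∘ patternWindow-swap τ≡σ′ , inj₁ ∘ patternWindow-swap σ≡τ′ ]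

  W⇒pattern : ∀ {ds cs} → W ds cs → ∃ λ ρ → EndsBefore _ (word ρ) × PatternWindow ρ ds cs
  W⇒pattern (inj₁ w) = σ , σ-ends , w
  W⇒pattern (inj₂ w) = τ , subst (EndsBefore _) (sym τ≡σ′) (endsBefore-swapMiddle (word σ) σ-ends) , w

  disjoint : NonOverlapping W
  disjoint = endsBefore-nonOverlapping ≺-asym ∼-reflects W⇒pattern

  φ : CellSet n m → CellSet n m
  φ F = proj₁ (swapWindows-total W? (cells D) F)

  φ-swaps : ∀ F → Swapped W (cells D) F (φ F)
  φ-swaps F = proj₂ (swapWindows-total W? (cells D) F)

  -- Avoidance holds by contraposition: an occurrence of `ρ′` in `φ F` becomes an occurrence of `ρ`
  -- in `F` when the exchange is undone.
  counted-swapped : (ρ ρ′ : Pattern 4) →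
    (∀ {ds cs} → PatternWindow ρ′ ds cs → W ds cs) →
    (∀ {ds cs} → PatternWindow ρ′ ds cs → PatternWindow ρ ds (swapMiddle cs)) →
    ∀ {F} → Counted D R C ρ F → Counted D R C ρ′ (φ F)
  counted-swapped ρ ρ′ ρ′⇒W ρ′⇒ρ {F} (filling , avoids , emptyRows , emptyColumns) =
    filling′ ,
    (λ contains → avoids (occurs⇒contains D ρ
      (occurs-unswapped W-swap disjoint
        ρ′⇒W ρ′⇒ρ (φ-swaps F)
        (contains⇒occurs D ρ′ (proj₁ (proj₂ filling′)) contains)))) ,
    swapped-emptyRows D (φ-swaps F) emptyRows ,
    swapped-emptyColumns D (φ-swaps F) W⇒pattern′ emptyColumns
    where
    W⇒pattern′ : ∀ {ds cs} → W ds cs → ∃ λ ρ → PatternWindow ρ ds cs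
    W⇒pattern′ w with ρ , _ , x ← W⇒pattern w = ρ , x

    filling′ : IsFilling D (φ F)
    filling′ = swapped-isFilling D (φ-swaps F) W⇒pattern′ filling

swapMiddle-≡fs-< : (σ τ : Pattern 4) → EndsBefore _<_ (word σ) → word τ ≡ swapMiddle (word σ) → σ ≡fs τ
swapMiddle-≡fs-< = swapMiddle-≡fs ℕ.<-asym λ v w v∼w p q → from (v∼w p q)

swapMiddle-≡fs-> : (σ τ : Pattern 4) → EndsBefore _>_ (word σ) → word τ ≡ swapMiddle (word σ) → σ ≡fs τ
-- Unfolding `_>_` reverses the two positions, hence `q p`.
swapMiddle-≡fs-> = swapMiddle-≡fs ℕ.<-asym λ v w v∼w p q → from (v∼w q p)

corollary3p6 : (p1342 ≡fs p1432) × (p2341 ≡fs p2431) × (p4213 ≡fs p4123) × (p3214 ≡fs p3124)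
corollary3p6 =
  swapMiddle-≡fs-< p1342 p1432 (from-yes ((1 ℕ.<? 3 ×-dec 1 ℕ.<? 4) ×-dec (2 ℕ.<? 3 ×-dec 2 ℕ.<? 4))) refl ,
  swapMiddle-≡fs-< p2341 p2431 (from-yes ((2 ℕ.<? 3 ×-dec 2 ℕ.<? 4) ×-dec (1 ℕ.<? 3 ×-dec 1 ℕ.<? 4))) refl ,
  swapMiddle-≡fs-> p4213 p4123 (from-yes ((2 ℕ.<? 4 ×-dec 1 ℕ.<? 4) ×-dec (2 ℕ.<? 3 ×-dec 1 ℕ.<? 3))) refl ,
  swapMiddle-≡fs-> p3214 p3124 (from-yes ((2 ℕ.<? 3 ×-dec 1 ℕ.<? 3) ×-dec (2 ℕ.<? 4 ×-dec 1 ℕ.<? 4))) refl
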